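{- For any circulation $X\colon E\to\mathbb Z$ on a directed graph $G=(V,E,c)$, there exists a circulation $Y\colon E\to\mathbb Z$ such that $X\equiv_2 Y$ and $\Vert Y\Vert\le 1$.
   Context: $G=(V,E,c)$ is a directed graph with no sources and no sinks, with a cost function $c\colon E\to\mathbb R_{\ge0}$. A circulation is a function $X$ on $E$ such that at every node the sum of values on incoming edges equals the sum of values on outgoing edges. $\Vert X\Vert=\max_{e\in E}|X(e)|$. $X\equiv_2Y$ means that for every $e\in E$, $X(e)$ is odd if and only if $Y(e)$ is odd. -}

module Defs where

open import Data.Nat.Base as ℕ using (ℕ; suc)
open import Data.Integer.Base as ℤ using (ℤ; +_; 0ℤ; 1ℤ; ∣_∣)
open import Data.Rational.Base as ℚ using (ℚ)
open import Data.Fin.Base using (Fin)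
open import Data.Fin.Properties using (_≟_)
open import Data.List.Base using (List; allFin; filter; foldr; map)
open import Data.List.Extrema.Nat using (max)
open import Data.Product.Base using (∃-syntax)
open import Function.Bundles using (_⇔_)
open import Relation.Binary.PropositionalEquality.Core using (_≡_)

-- Non-negative reals in the style of Bishop: regular sequences of rationals,
-- with index k standing for precision 1/(k+1).  Equality of reals is not
-- needed, so the sequences are not identified up to their limits.

precision : ℕ → ℚ
precision k = + 1 ℚ./ suc k

record ℝ≥0 : Set where
  field
    approx      : ℕ → ℚ
    regular     : ∀ j k → ℚ.∣ approx j ℚ.- approx k ∣ ℚ.≤ precision j ℚ.+ precision k
    nonNegative : ∀ k → ℚ.- precision k ℚ.≤ approx k

-- Loops and parallel edges are allowed; a simple graph is the special case in
-- which an edge is determined by its source and target.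

record Digraph : Set where
  field
    ∣V∣ ∣E∣ : ℕ

  V : Set
  V = Fin ∣V∣

  E : Set
  E = Fin ∣E∣

  field
    source target : E → V
    cost          : E → ℝ≥0
    noSource      : ∀ v → ∃[ e ] target e ≡ v
    noSink        : ∀ v → ∃[ e ] source e ≡ v

  edges : List E
  edges = allFin ∣E∣

  incoming outgoing : V → List E
  incoming v = filter (λ e → target e ≟ v) edges
  outgoing v = filter (λ e → source e ≟ v) edges

  sumOver : (E → ℤ) → List E → ℤ
  sumOver X es = foldr ℤ._+_ 0ℤ (map X es)

  IsCirculation : (E → ℤ) → Set
  IsCirculation X = ∀ v → sumOver X (incoming v) ≡ sumOver X (outgoing v)

  -- The base value 0 only matters when there are no edges.
  ‖_‖ : (E → ℤ) → ℕ
  ‖ X ‖ = max 0 (map (λ e → ∣ X e ∣) edges)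

Odd : ℤ → Set
Odd i = ∃[ k ] i ≡ + 2 ℤ.* k ℤ.+ 1ℤ

infix 4 _≡₂_

_≡₂_ : {A : Set} → (A → ℤ) → (A → ℤ) → Set
X ≡₂ Y = ∀ e → Odd (X e) ⇔ Odd (Y e)

{-# OPTIONS --safe #-}

-- On the edges where X is odd every node has even degree, so these edges have
-- a balanced orientation Y = ±1.  It is found by following trails: when the
-- current trail leads from u to v ≠ u, parity at v forces one of the remaining
-- odd edges to be incident with v, and that edge extends the trail.

module Submission where

open import Defs
open import Data.Nat.Base using (ℕ; zero; suc; _≤_; z≤n; s≤s)
open import Data.Nat.Properties using (≤-refl)
open import Data.Integer.Base using (ℤ; +_; 0ℤ; 1ℤ; -1ℤ; _+_; _-_; _*_; -_; ∣_∣)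
open import Data.Integer.Properties
  using (+-identityˡ; +-identityʳ; +-inverseʳ; +-assoc; *-identityʳ; *-zeroʳ;
         neg-distribˡ-*; +-0-abelianGroup; +-*-semiring)
open import Data.Integer.DivMod using (_%ℕ_; _/ℕ_; n%ℕd<d; a≡a%ℕn+[a/ℕn]*n)
open import Data.Integer.Divisibility.Signed
  using (_∣_; divides; _∣?_; ∣m∣n⇒∣m+n; ∣m∣n⇒∣m-n; ∣m⇒∣m*n; ∣n⇒∣m*n)
open import Data.Integer.Tactic.RingSolver using (solve-∀)
open import Data.Fin.Base using (Fin; zero; suc; punchIn; punchOut)
open import Data.Fin.Properties using (_≟_; any?; punchIn-punchOut)
open import Data.List.Base using (filter; foldr; map; tabulate)
open import Data.List.Extrema.Nat using (max≤v⁺)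
import Data.List.Relation.Unary.All.Properties as All
open import Data.Product.Base using (_×_; _,_; proj₁; proj₂; ∃-syntax)
open import Data.Sum.Base using (_⊎_; inj₁; inj₂)
open import Data.Vec.Functional using (Vector; []; insertAt; removeAt)
open import Data.Vec.Functional.Properties using (insertAt-lookup; insertAt-punchIn)
open import Function.Base using (_∘_; id)
open import Function.Bundles using (mk⇔)
open import Relation.Binary.PropositionalEquality
open import Relation.Nullary.Decidable using (from-no)
open import Relation.Nullary using (¬_; yes; no; contradiction; ¬?; _×-dec_; _⊎-dec_)
open import Algebra.Bundles using (AbelianGroup)
open import Algebra.Properties.Group (AbelianGroup.group +-0-abelianGroup) using (∙-cancelʳ)
open import Algebra.Properties.Semiring.Sum +-*-semiring
  using (sum; sum-remove; ∑-distrib-+; sum-cong-≗)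

open ≡-Reasoning

-- Parity of integers.

Even : ℤ → Set
Even i = + 2 ∣ i

even⊎odd : ∀ i → Even i ⊎ Odd i
even⊎odd i with i %ℕ 2 | n%ℕd<d i 2 | a≡a%ℕn+[a/ℕn]*n i 2
... | 0 | _ | eq = inj₁ (divides (i /ℕ 2) (trans eq (+-identityˡ _)))
... | 1 | _ | eq = inj₂ (i /ℕ 2 , trans eq (comm (i /ℕ 2)))
  where
  comm : ∀ q → 1ℤ + q * + 2 ≡ + 2 * q + 1ℤ
  comm = solve-∀
... | suc (suc _) | s≤s (s≤s ()) | _

odd-≡₂ : ∀ i j → Even (i - j) → Odd i → Odd j
odd-≡₂ i j (divides q i-j≡q*2) (k , i≡2k+1) = k - q , (begin
  j                          ≡⟨ flip i j ⟩
  i - (i - j)                ≡⟨ cong₂ _-_ i≡2k+1 i-j≡q*2 ⟩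
  + 2 * k + 1ℤ - q * + 2     ≡⟨ collect k q ⟩
  + 2 * (k - q) + 1ℤ         ∎)
  where
  flip : ∀ i j → j ≡ i - (i - j)
  flip = solve-∀
  collect : ∀ k q → + 2 * k + 1ℤ - q * + 2 ≡ + 2 * (k - q) + 1ℤ
  collect = solve-∀

even-sym : ∀ i j → Even (i - j) → Even (j - i)
even-sym i j (divides q eq) = divides (- q) (begin
  j - i        ≡⟨ swap i j ⟩
  - (i - j)    ≡⟨ cong -_ eq ⟩
  - (q * + 2)  ≡⟨ neg-distribˡ-* q (+ 2) ⟩
  - q * + 2    ∎)
  where
  swap : ∀ i j → j - i ≡ - (i - j)
  swap = solve-∀

¬even⇒even-1 : ∀ {i} → ¬ Even i → Even (i - 1ℤ)
¬even⇒even-1 {i} ¬e with even⊎odd i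
... | inj₁ e          = contradiction e ¬e
... | inj₂ (k , refl) = divides k (drop k)
  where
  drop : ∀ k → + 2 * k + 1ℤ - 1ℤ ≡ k * + 2
  drop = solve-∀

¬even⇒even+1 : ∀ {i} → ¬ Even i → Even (i - -1ℤ)
¬even⇒even+1 {i} ¬e = subst Even (shift i) (∣m∣n⇒∣m+n (¬even⇒even-1 ¬e) (divides 1ℤ refl))
  where
  shift : ∀ i → i - 1ℤ + + 2 ≡ i - -1ℤ
  shift = solve-∀

even-sum : ∀ {n} (f : Vector ℤ n) → (∀ i → Even (f i)) → Even (sum f)
even-sum {zero}  f e = divides 0ℤ refl
even-sum {suc n} f e = ∣m∣n⇒∣m+n (e zero) (even-sum (f ∘ suc) (e ∘ suc))

-- Net flow on vectors of edges.

module _ {m : ℕ} where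

  δ : Fin m → Fin m → ℤ
  δ u w with u ≟ w
  ... | yes _ = 1ℤ
  ... | no  _ = 0ℤ

  δ-refl : ∀ v → δ v v ≡ 1ℤ
  δ-refl v with v ≟ v
  ... | yes _  = refl
  ... | no v≢v = contradiction refl v≢v

  δ-≢ : ∀ {u v} → u ≢ v → δ u v ≡ 0ℤ
  δ-≢ {u} {v} u≢v with u ≟ v
  ... | yes u≡v = contradiction u≡v u≢v
  ... | no _    = refl

  -- A column of the signed incidence matrix: loops give zero, and reversing an edge changes the
  -- sign.
  ∂ : Fin m × Fin m → Fin m → ℤ
  ∂ (u , v) w = δ v w - δ u w

  -- Inflow minus outflow at `w`. Edges form a bare vector of pairs, not a `Digraph`, because
  -- deleting edges may create sources and sinks.
  net : ∀ {n} → Vector (Fin m × Fin m) n → Vector ℤ n → Fin m → ℤ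
  net es X w = sum (λ i → X i * ∂ (es i) w)

  net-remove : ∀ {n} (es : Vector (Fin m × Fin m) (suc n)) X i w →
    net es X w ≡ X i * ∂ (es i) w + net (removeAt es i) (removeAt X i) w
  net-remove es X i w = sum-remove {i = i} (λ j → X j * ∂ (es j) w)

  net-insert : ∀ {n} (es : Vector (Fin m × Fin m) (suc n)) Y i y w →
    net es (insertAt Y i y) w ≡ y * ∂ (es i) w + net (removeAt es i) Y w
  net-insert es Y i y w = trans (net-remove es (insertAt Y i y) i w)
    (cong₂ _+_ (cong (_* ∂ (es i) w) (insertAt-lookup Y i y))
               (sum-cong-≗ λ j → cong (_* ∂ (removeAt es i j) w) (insertAt-punchIn Y i y j)))

  -- Balanced values by following trails.

  Rounding : ∀ {n} → Vector ℤ n → Vector ℤ n → Set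
  Rounding X Y = ∀ i → ∣ Y i ∣ ≤ 1 × Even (X i - Y i)

  -- The current trail enters only through its ends p: it is contracted to a
  -- single edge with coefficient 1 (a loop for the empty trail).
  Closable : ∀ {n} → Fin m × Fin m → Vector (Fin m × Fin m) n → Vector ℤ n → Set
  Closable p es X = (∀ w → Even (∂ p w + net es X w)) →
    ∃[ Y ] (Rounding X Y × (∀ w → ∂ p w + net es Y w ≡ 0ℤ))

  rounding-insert : ∀ {n} {X : Vector ℤ (suc n)} {Y} i {y} → ∣ y ∣ ≤ 1 → Even (X i - y) →
    Rounding (removeAt X i) Y → Rounding X (insertAt Y i y)
  rounding-insert {X = X} {Y} i {y} ∣y∣≤1 e r j with i ≟ j
  ... | yes refl rewrite insertAt-lookup Y i y = ∣y∣≤1 , e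
  ... | no i≢j = subst (λ k → ∣ insertAt Y i y k ∣ ≤ 1 × Even (X k - insertAt Y i y k))
                   (punchIn-punchOut i≢j) at-punchIn
    where
    at-punchIn : ∣ insertAt Y i y (punchIn i (punchOut i≢j)) ∣ ≤ 1 ×
                 Even (X (punchIn i (punchOut i≢j)) - insertAt Y i y (punchIn i (punchOut i≢j)))
    at-punchIn rewrite insertAt-punchIn Y i y (punchOut i≢j) = r (punchOut i≢j)

  -- One step of a trail: edge `i` gets its final value `y` and is absorbed into the contracted
  -- edge, whose ends change from `p` to `q`. Replacing `X i` by `y` alters each node's balance by a
  -- multiple of the even number `X i - y`, so the parity hypothesis passes to the remaining edges.
  extend : ∀ {n} p q (es : Vector (Fin m × Fin m) (suc n)) X i y →
    ∣ y ∣ ≤ 1 → Even (X i - y) → (∀ w → ∂ p w + y * ∂ (es i) w ≡ ∂ q w) →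
    Closable q (removeAt es i) (removeAt X i) → Closable p es X
  extend p q es X i y ∣y∣≤1 e p+y≡q close even =
    let Y , r , balanced = close even′ in
    insertAt Y i y , rounding-insert {X = X} i ∣y∣≤1 e r , λ w → begin
      ∂ p w + net es (insertAt Y i y) w                         ≡⟨ cong (λ s → ∂ p w + s) (net-insert es Y i y w) ⟩
      ∂ p w + (y * ∂ (es i) w + net (removeAt es i) Y w)        ≡⟨ +-assoc (∂ p w) _ _ ⟨
      ∂ p w + y * ∂ (es i) w + net (removeAt es i) Y w          ≡⟨ cong₂ _+_ (p+y≡q w) refl ⟩
      ∂ q w + net (removeAt es i) Y w                           ≡⟨ balanced w ⟩
      0ℤ                                                        ∎
    where
    rearrange : ∀ a d x y r → a + (x * d + r) - (x - y) * d ≡ a + y * d + r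
    rearrange = solve-∀
    even′ : ∀ w → Even (∂ q w + net (removeAt es i) (removeAt X i) w)
    even′ w = subst Even eq (∣m∣n⇒∣m-n (even w) (∣m⇒∣m*n (∂ (es i) w) e))
      where
      rest = net (removeAt es i) (removeAt X i) w
      eq : ∂ p w + net es X w - (X i - y) * ∂ (es i) w ≡ ∂ q w + rest
      eq = begin
        ∂ p w + net es X w - (X i - y) * ∂ (es i) w
          ≡⟨ cong (λ s → ∂ p w + s - (X i - y) * ∂ (es i) w) (net-remove es X i w) ⟩
        ∂ p w + (X i * ∂ (es i) w + rest) - (X i - y) * ∂ (es i) w
          ≡⟨ rearrange (∂ p w) (∂ (es i) w) (X i) y rest ⟩
        ∂ p w + y * ∂ (es i) w + rest
          ≡⟨ cong (_+ rest) (p+y≡q w) ⟩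
        ∂ q w + rest
          ∎

  -- Otherwise every term of `net es X v` is even: either its coefficient is even, or its edge
  -- misses `v` and has boundary 0 there. The open trail contributes 1 at `v`, so the total would be
  -- odd.
  odd-incident-edge : ∀ {n u v} (es : Vector (Fin m × Fin m) n) X → u ≢ v →
    Even (∂ (u , v) v + net es X v) →
    ∃[ i ] (¬ Even (X i) × (proj₁ (es i) ≡ v ⊎ proj₂ (es i) ≡ v))
  odd-incident-edge {u = u} {v} es X u≢v even
    with any? (λ i → ¬? (+ 2 ∣? X i) ×-dec ((proj₁ (es i) ≟ v) ⊎-dec (proj₂ (es i) ≟ v)))
  ... | yes found = found
  ... | no  none  = contradiction (∣m∣n⇒∣m-n even (even-sum _ even-term)) odd-one
    where
    even-term : ∀ i → Even (X i * ∂ (es i) v)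
    even-term i with + 2 ∣? X i
    ... | yes e = ∣m⇒∣m*n _ e
    ... | no ¬e = ∣n⇒∣m*n (X i) (divides 0ℤ (cong₂ _-_
                    (δ-≢ λ t≡v → none (i , ¬e , inj₂ t≡v))
                    (δ-≢ λ s≡v → none (i , ¬e , inj₁ s≡v))))
    cancel : ∀ a b → a + b - b ≡ a
    cancel = solve-∀
    odd-one : ¬ Even (∂ (u , v) v + net es X v - net es X v)
    odd-one e = from-no (+ 2 ∣? 1ℤ)
      (subst Even (trans (cancel (∂ (u , v) v) (net es X v)) (cong₂ _-_ (δ-refl v) (δ-≢ u≢v))) e)

  -- Induction on the number of remaining edges, since each step uses up one. An open trail with no
  -- edges left cannot occur: the odd edge at `v` would have an index in `Fin 0`.
  closable : ∀ n (es : Vector (Fin m × Fin m) n) X p → Closable p es X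
  closable n es X (u , v) even with u ≟ v
  closable zero es X (u , u) even | yes refl =
    [] , (λ ()) , λ w → trans (+-identityʳ _) (+-inverseʳ (δ u w))
  closable (suc n) es X (u , u) even | yes refl with + 2 ∣? X zero
  -- Even edges met between trails are discarded with value 0.
  ... | yes e = extend (u , u) (u , u) es X zero 0ℤ z≤n (subst Even (sym (+-identityʳ _)) e)
                  (λ w → +-identityʳ _) (closable n (removeAt es zero) (removeAt X zero) (u , u)) even
  -- A closed trail has zero boundary, so it can be forgotten and a new trail begun along this odd
  -- edge.
  ... | no ¬e = extend (u , u) (es zero) es X zero 1ℤ ≤-refl (¬even⇒even-1 ¬e)
                  (λ w → start (δ u w) (∂ (es zero) w)) (closable n (removeAt es zero) (removeAt X zero) (es zero)) even
    where
    start : ∀ a d → a - a + 1ℤ * d ≡ d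
    start = solve-∀
  closable n es X (u , v) even | no u≢v with odd-incident-edge es X u≢v (even v)
  -- The edge leaves `v` and is traversed forwards, hence the value 1. A loop at `v` keeps the ends
  -- but still shortens the vector.
  closable (suc n) es X (u , v) even | no u≢v | i , ¬e , inj₁ refl =
    extend (u , v) (u , proj₂ (es i)) es X i 1ℤ ≤-refl (¬even⇒even-1 ¬e)
      (λ w → forward (δ u w) (δ v w) (δ (proj₂ (es i)) w))
      (closable n (removeAt es i) (removeAt X i) (u , proj₂ (es i))) even
    where
    forward : ∀ a b c → b - a + 1ℤ * (c - b) ≡ c - a
    forward = solve-∀
  -- The edge enters `v`; traversing it backwards gives the value -1.
  closable (suc n) es X (u , v) even | no u≢v | i , ¬e , inj₂ refl =
    extend (u , v) (u , proj₁ (es i)) es X i -1ℤ ≤-refl (¬even⇒even+1 ¬e)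
      (λ w → backward (δ u w) (δ v w) (δ (proj₁ (es i)) w))
      (closable n (removeAt es i) (removeAt X i) (u , proj₁ (es i))) even
    where
    backward : ∀ a b c → b - a + -1ℤ * (b - c) ≡ c - a
    backward = solve-∀

  round : ∀ {n} (es : Vector (Fin m × Fin m) n) X → (∀ w → net es X w ≡ 0ℤ) →
    ∃[ Y ] (Rounding X Y × (∀ w → net es Y w ≡ 0ℤ))
  -- Without edges there may be no node at which to place the empty trail.
  round {zero}  es X balanced = X , (λ ()) , balanced
  round {suc n} es X balanced = let u = proj₁ (es zero)
                                    Y , r , balanced′ = closable _ es X (u , u) (even u) in
    Y , r , λ w → trans (sym (loop u w _)) (balanced′ w)
    where
    loop : ∀ u w a → ∂ (u , u) w + a ≡ a
    loop u w a = trans (cong (_+ a) (+-inverseʳ (δ u w))) (+-identityˡ a)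
    even : ∀ u w → Even (∂ (u , u) w + net es X w)
    even u w = divides 0ℤ (trans (loop u w _) (balanced w))

  -- The general `g` lets the induction pass to `g ∘ suc`; the edge list is the case `g = id`.
  sum-filter : ∀ {n} {A : Set} (X : A → ℤ) (f : A → Fin m) (g : Fin n → A) v →
    foldr _+_ 0ℤ (map X (filter (λ e → f e ≟ v) (tabulate g))) ≡ sum (λ i → X (g i) * δ (f (g i)) v)
  sum-filter {zero}  X f g v = refl
  sum-filter {suc n} X f g v with f (g zero) ≟ v
  ... | yes _ = cong₂ _+_ (sym (*-identityʳ (X (g zero)))) (sum-filter X f (g ∘ suc) v)
  ... | no  _ = trans (sum-filter X f (g ∘ suc) v)
                  (sym (trans (cong₂ _+_ (*-zeroʳ (X (g zero))) refl) (+-identityˡ _)))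

-- Circulations as vanishing net flow.

module _ (G : Digraph) where
  open Digraph G

  ends : Vector (V × V) ∣E∣
  ends e = source e , target e

  net+out≡in : ∀ X v → net ends X v + sumOver X (outgoing v) ≡ sumOver X (incoming v)
  net+out≡in X v = begin
    net ends X v + sumOver X (outgoing v)
      ≡⟨ cong (λ s → net ends X v + s) (sum-filter X source id v) ⟩
    net ends X v + sum (λ e → X e * δ (source e) v)
      ≡⟨ ∑-distrib-+ (λ e → X e * ∂ (ends e) v) (λ e → X e * δ (source e) v) ⟨
    sum (λ e → X e * ∂ (ends e) v + X e * δ (source e) v)
      ≡⟨ sum-cong-≗ (λ e → cancel (X e) (δ (target e) v) (δ (source e) v)) ⟩
    sum (λ e → X e * δ (target e) v)
      ≡⟨ sum-filter X target id v ⟨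
    sumOver X (incoming v)
      ∎
    where
    cancel : ∀ x t s → x * (t - s) + x * s ≡ x * t
    cancel = solve-∀

  circulation⇒net≡0 : ∀ {X} → IsCirculation X → ∀ v → net ends X v ≡ 0ℤ
  circulation⇒net≡0 {X} circ v = ∙-cancelʳ (sumOver X (outgoing v)) _ _
    (trans (net+out≡in X v) (trans (circ v) (sym (+-identityˡ _))))

  net≡0⇒circulation : ∀ {X} → (∀ v → net ends X v ≡ 0ℤ) → IsCirculation X
  net≡0⇒circulation {X} balanced v = trans (sym (net+out≡in X v))
    (trans (cong₂ _+_ (balanced v) refl) (+-identityˡ _))

lemma21 : (G : Digraph) → let open Digraph G in
    (X : E → ℤ) → IsCirculation X →
    ∃[ Y ] (IsCirculation Y × (X ≡₂ Y) × (‖ Y ‖ ≤ 1))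
lemma21 G X circ =
  let Y , r , balanced = round (ends G) X (circulation⇒net≡0 G circ) in
  Y , net≡0⇒circulation G balanced
    , (λ e → mk⇔ (odd-≡₂ (X e) (Y e) (proj₂ (r e)))
                  (odd-≡₂ (Y e) (X e) (even-sym (X e) (Y e) (proj₂ (r e)))))
    -- Here `z≤n` bounds the base value 0 of the maximum.
    , max≤v⁺ {xs = map (λ e → ∣ Y e ∣) (Digraph.edges G)} z≤n
        (All.map⁺ (All.tabulate⁺ (proj₁ ∘ r)))
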